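{- Let $n\ge 0$ and let $\sigma\in I_n$ be an inversion sequence of length $n$. Then $\Theta(\sigma)=\sigma$ if and only if the following two conditions hold: (i) $\sigma$ avoids the pattern $101$; (ii) whenever a value $v$ appears in $\sigma$ (i.e. $v=\sigma_p$ for some $p\in[1,n]$), one has $\sigma_{v+1}=v$.
   Context: For integers $a\le b$, $[a,b]=\{i\in\mathbb Z: a\le i\le b\}$. $I_n$ is the set of inversion sequences of length $n$, i.e. integer sequences $\sigma=(\sigma_1,\ldots,\sigma_n)$ with $0\le\sigma_i<i$ for every $i\in[1,n]$. For a finite integer sequence $\sigma$ of length $n$, $\Theta(\sigma)$ is the sequence of length $n$ defined by $\Theta(\sigma)_i=\#\{j<i:\sigma_j<\sigma_i\}$ for $i\in[1,n]$. A sequence avoids $101$ if there are no indices $a<b<c$ with $\sigma_a=\sigma_c>\sigma_b$. -}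

module Defs where

open import Data.Nat using (ℕ; suc; _+_; _<_; _<?_)
open import Data.Fin as Fin using (Fin; toℕ)
open import Data.List using (length; filter; allFin)
open import Data.Product using (∃-syntax; _×_)
open import Data.Vec using (Vec; lookup; tabulate)
open import Data.Vec.Membership.Propositional using (_∈_)
open import Relation.Binary.PropositionalEquality using (_≡_)
open import Relation.Nullary using (¬_)
open import Relation.Nullary.Decidable using (_×-dec_)

-- The mathematical convention indexes sequences by [1,n]; `lookup σ i` is the
-- entry at the 1-based position `pos i`.
pos : ∀ {n} → Fin n → ℕ
pos i = suc (toℕ i)

IsInversionSequence : ∀ {n} → Vec ℕ n → Set
IsInversionSequence σ = ∀ i → lookup σ i < pos i

Θ : ∀ {n} → Vec ℕ n → Vec ℕ n
Θ {n} σ = tabulate λ i →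
  length (filter (λ j → (j Fin.<? i) ×-dec (lookup σ j <? lookup σ i)) (allFin n))

Avoids101 : ∀ {n} → Vec ℕ n → Set
Avoids101 σ = ¬ (∃[ a ] ∃[ b ] ∃[ c ]
  a Fin.< b × b Fin.< c × lookup σ a ≡ lookup σ c × lookup σ b < lookup σ c)

-- σ_{v+1} = v for every value v of σ.  That position v + 1 lies in [1,n] is part
-- of the assertion; it is automatic for inversion sequences, as v = σ_p < p ≤ n.
ValuesAnchored : ∀ {n} → Vec ℕ n → Set
ValuesAnchored σ = ∀ v → v ∈ σ → ∃[ q ] pos q ≡ v + 1 × lookup σ q ≡ v

{-# OPTIONS --safe #-}

-- An entry v = σᵢ always has at least v smaller predecessors, namely the
-- entries at the 0-based positions j < v, for which σⱼ ≤ j < v ≤ i.  So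
-- Θ(σ)ᵢ = v says exactly that no further smaller entry occurs before i.  Such an
-- entry at a position j ≥ v is what breaks the anchor σᵥ = v (if j = v)
-- or forms a 101 pattern with positions v and i (if j > v).

module Submission where

open import Data.Fin as Fin using (Fin; zero; suc; toℕ; fromℕ<)
open import Data.Fin.Properties using (toℕ<n; toℕ-fromℕ<; toℕ-injective)
open import Data.List using (length; filter; tabulate)
open import Data.List.Properties using (filter-accept; filter-none; filter-some)
open import Data.List.Relation.Unary.All.Properties as All using ()
open import Data.List.Relation.Unary.Any.Properties as Any using ()
open import Data.Nat using (ℕ; zero; suc; _≤_; _<_; _≰_; _≮_; _<?_; z≤n; z<s; s≤s; s<s)
open import Data.Nat.Properties
open import Data.Product using (_×_; _,_)
open import Data.Sum using (inj₁; inj₂)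
open import Data.Vec using (Vec; lookup)
open import Data.Vec.Membership.Propositional.Properties using (∈-lookup)
open import Data.Vec.Properties using (lookup∘tabulate; tabulate-cong; tabulate∘lookup)
open import Data.Vec.Relation.Unary.Any using (index)
open import Data.Vec.Relation.Unary.Any.Properties using (lookup-index)
open import Function using (_∘_; id)
open import Function.Bundles using (_⇔_; mk⇔)
open import Level using (Level)
open import Relation.Binary.PropositionalEquality using (_≡_; sym; trans; cong; subst)
open import Relation.Nullary using (contradiction)
open import Relation.Nullary.Decidable using (_×-dec_)
open import Relation.Unary using (Pred; Decidable)
open import Defs

private
  variable
    a p : Level
    A : Set a
    P : Pred A p
    n v : ℕ

-- Each layer of `v ≤ n` peels off position 0, which is accepted while `v` is positive; once `v`
-- reaches 0, nothing is accepted. The enumeration `f` is arbitrary so that the recursion can pass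
-- to `f ∘ suc`.
length-filter-initial : (P? : Decidable P) (f : Fin n → A) → v ≤ n →
  (∀ j → toℕ j < v → P (f j)) → (∀ j → P (f j) → toℕ j < v) →
  length (filter P? (tabulate f)) ≡ v
length-filter-initial P? f z≤n below⇒P P⇒below =
  cong length (filter-none P? (All.tabulate⁺ λ j Pfj → contradiction (P⇒below j Pfj) n≮0))
length-filter-initial P? f (s≤s v≤n) below⇒P P⇒below =
  trans (cong length (filter-accept P? (below⇒P zero z<s)))
        (cong suc (length-filter-initial P? (f ∘ suc) v≤n
          (λ j → below⇒P (suc j) ∘ s<s)
          (λ j → ≤-pred ∘ P⇒below (suc j))))

-- The first `v` positions already account for the whole count. After they are peeled off, one more
-- accepted position would make a filtered list of length 0 nonempty.
length-filter-initial⁻ : (P? : Decidable P) (f : Fin n → A) → v ≤ n →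
  (∀ j → toℕ j < v → P (f j)) →
  length (filter P? (tabulate f)) ≡ v → ∀ j → P (f j) → toℕ j < v
length-filter-initial⁻ P? f z≤n below⇒P eq j Pfj =
  contradiction (subst (0 <_) eq (filter-some P? (Any.tabulate⁺ j Pfj))) n≮0
length-filter-initial⁻ P? f (s≤s v≤n) below⇒P eq zero    Pfj = z<s
length-filter-initial⁻ P? f (s≤s v≤n) below⇒P eq (suc j) Pfj =
  s<s (length-filter-initial⁻ P? (f ∘ suc) v≤n (λ k → below⇒P (suc k) ∘ s<s)
    (suc-injective (trans (sym (cong length (filter-accept P? (below⇒P zero z<s)))) eq)) j Pfj)

-- The condition through which both directions pass. In an inversion sequence every position below
-- the value at `i` is a smaller predecessor of `i`, so this makes the two sets of positions equal.
SmallerPredecessorsInitial : Vec ℕ n → Set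
SmallerPredecessorsInitial σ =
  ∀ i j → j Fin.< i → lookup σ j < lookup σ i → toℕ j < lookup σ i

module _ {n : ℕ} (σ : Vec ℕ n) (inv : IsInversionSequence σ) where

  private
    value≤n : ∀ i → lookup σ i ≤ n
    value≤n i = ≤-trans (≤-pred (inv i)) (<⇒≤ (toℕ<n i))

    initial⇒smaller : ∀ i j → toℕ j < lookup σ i → j Fin.< i × lookup σ j < lookup σ i
    initial⇒smaller i j j<v = <-≤-trans j<v (≤-pred (inv i)) , ≤-<-trans (≤-pred (inv j)) j<v

    smaller? : ∀ i → Decidable (λ j → j Fin.< i × lookup σ j < lookup σ i)
    smaller? i j = (j Fin.<? i) ×-dec (lookup σ j <? lookup σ i)

  Θ-fixed⇒initial : Θ σ ≡ σ → SmallerPredecessorsInitial σ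
  Θ-fixed⇒initial fixed i j j<i σj<σi =
    -- `allFin n` unfolds to `tabulate id`, hence the enumeration `id`.
    length-filter-initial⁻ (smaller? i) id (value≤n i) (initial⇒smaller i)
      (trans (sym (lookup∘tabulate _ i)) (cong (λ τ → lookup τ i) fixed)) j (j<i , σj<σi)

  initial⇒Θ-fixed : SmallerPredecessorsInitial σ → Θ σ ≡ σ
  initial⇒Θ-fixed initial = trans
    (tabulate-cong λ i → length-filter-initial (smaller? i) id (value≤n i)
      (initial⇒smaller i) (λ { j (j<i , σj<σi) → initial i j j<i σj<σi }))
    (tabulate∘lookup σ)

  -- The smaller entry at `b` precedes `c`, so `b < σ_c = σ_a ≤ a`, against `a < b`.
  initial⇒avoids101 : SmallerPredecessorsInitial σ → Avoids101 σ
  initial⇒avoids101 initial (a , b , c , a<b , b<c , σa≡σc , σb<σc) =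
    <-asym a<b (<-≤-trans (initial c b b<c σb<σc) (subst (_≤ toℕ a) σa≡σc (≤-pred (inv a))))

  initial⇒anchored : SmallerPredecessorsInitial σ → ValuesAnchored σ
  initial⇒anchored initial v v∈σ =
    q , trans (cong suc q≡v) (+-comm 1 v) , ≤-antisym σq≤v (≮⇒≥ σq≮v)
    where
    i = index v∈σ

    v≡σi : v ≡ lookup σ i
    v≡σi = lookup-index v∈σ

    v≤i : v ≤ toℕ i
    v≤i = subst (_≤ toℕ i) (sym v≡σi) (≤-pred (inv i))

    v<n : v < n
    v<n = ≤-<-trans v≤i (toℕ<n i)

    q : Fin n
    q = fromℕ< v<n

    q≡v : toℕ q ≡ v
    q≡v = toℕ-fromℕ< v<n

    σq≤v : lookup σ q ≤ v
    σq≤v = subst (lookup σ q ≤_) q≡v (≤-pred (inv q))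

    σq≮v : lookup σ q ≮ v
    -- If `q` precedes `i`, it is a smaller predecessor, which forces `q < v` although `q` is the
    -- position `v`; if `q` is `i`, its entry is `v` itself.
    σq≮v σq<v with m≤n⇒m<n∨m≡n (subst (_≤ toℕ i) (sym q≡v) v≤i)
    ... | inj₁ q<i = <-irrefl (trans q≡v v≡σi) (initial i q q<i (subst (lookup σ q <_) v≡σi σq<v))
    ... | inj₂ q≡i = <-irrefl (trans (cong (lookup σ) (toℕ-injective q≡i)) (sym v≡σi)) σq<v

  avoids101∧anchored⇒initial : Avoids101 σ → ValuesAnchored σ → SmallerPredecessorsInitial σ
  avoids101∧anchored⇒initial avoids anchored i j j<i σj<σi
    with q , posq≡v+1 , σq≡v ← anchored (lookup σ i) (∈-lookup i σ) = ≰⇒> v≰j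
    where
    -- The 1-based position `v + 1` of the anchor is the 0-based position `v`.
    q≡v : toℕ q ≡ lookup σ i
    q≡v = suc-injective (trans posq≡v+1 (+-comm _ 1))

    v≰j : lookup σ i ≰ toℕ j
    v≰j v≤j with m≤n⇒m<n∨m≡n (subst (_≤ toℕ j) (sym q≡v) v≤j)
    ... | inj₁ q<j = avoids (q , j , i , q<j , j<i , σq≡v , σj<σi)
    ... | inj₂ q≡j = <-irrefl (trans (cong (lookup σ) (sym (toℕ-injective q≡j))) σq≡v) σj<σi

theorem4p5 : ∀ (n : ℕ) (σ : Vec ℕ n) → IsInversionSequence σ →
    (Θ σ ≡ σ) ⇔ (Avoids101 σ × ValuesAnchored σ)
theorem4p5 n σ inv = mk⇔
  (λ fixed → let initial = Θ-fixed⇒initial σ inv fixed in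
    initial⇒avoids101 σ inv initial , initial⇒anchored σ inv initial)
  (λ { (avoids , anchored) →
    initial⇒Θ-fixed σ inv (avoids101∧anchored⇒initial σ inv avoids anchored) })
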